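{- Let $T$ be a complete first-order theory in a language $L$. If $T$ is VC-minimal, then $T$ is convexly orderable.
   Context: $\mathfrak{C}$ denotes a monster model of $T$. "Formula" means an $L$-formula without parameters unless stated otherwise; $x$ denotes a single variable, $\overline{y}$ a finite tuple of variables, $\mathrm{lg}(\overline{y})$ its length, and $\varphi(M;\overline{b}) = \{a \in M : \models \varphi(a;\overline{b})\}$. Independence dimension: for a set $X$ and $\mathcal{A} \subseteq \mathcal{P}(X)$, put $B^1 = B$ and $B^0 = X \setminus B$ for $B \subseteq X$. A family $\mathcal{B} \subseteq \mathcal{P}(X)$ is independent with respect to $X$ if $\bigcap_{B \in \mathcal{B}} B^{s(B)} \neq \emptyset$ for every function $s : \mathcal{B} \to \{0,1\}$. $\mathcal{A}$ has independence dimension $N$ with respect to $X$ if $N$ is maximal such that some $\mathcal{B} \subseteq \mathcal{A}$ with $|\mathcal{B}| = N$ is independent with respect to $X$. VC-minimal: a set of formulas $\Phi = \{\varphi_i(x;\overline{y}_i) : i \in I\}$ is a VC-instantiable family if $\{\varphi_i(\mathfrak{C};\overline{b}) : i \in I, \overline{b} \in \mathfrak{C}^{\mathrm{lg}(\overline{y}_i)}\}$ has independence dimension $\le 1$ with respect to $\mathfrak{C}$. An instance of $\Phi$ is a formula $\varphi_i(x;\overline{b})$ with $i \in I$, $\overline{b} \in \mathfrak{C}^{\mathrm{lg}(\overline{y}_i)}$. $T$ is VC-minimal if there is a VC-instantiable family $\Phi$ such that every formula $\psi(x)$ with parameters from $\mathfrak{C}$ is $T$-equivalent to a boolean combination of instances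 of $\Phi$. Convexly orderable: an $L$-structure $M$ is convexly orderable if there is a linear order $<$ on $M$ (not necessarily definable) such that for every $L$-formula $\varphi(x;\overline{y})$ there is $K < \omega$ such that for all $\overline{b} \in M^{\mathrm{lg}(\overline{y})}$, $\varphi(M;\overline{b})$ is a union of at most $K$ $<$-convex subsets of $M$. A theory is convexly orderable if all of its models are. -}

module Defs where

open import Data.Bool using (Bool; true; false)
open import Data.Empty.Polymorphic using (⊥)
open import Data.Fin using (Fin)
open import Data.List using (List)
open import Data.List.Relation.Unary.All using (All)
open import Data.Nat using (ℕ; suc; _+_; _≤_)
open import Data.Product using (Σ; Σ-syntax; ∃-syntax; _×_; _,_)
open import Data.Sum using (_⊎_)
open import Data.Unit.Polymorphic using (⊤)
open import Data.Vec using (Vec; []; _∷_; _++_; lookup; map)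
open import Function.Bundles using (_↔_; _⇔_; Inverse)
open import Function.Definitions using (Injective)
open import Level using (Level; _⊔_) renaming (suc to lsuc)
open import Relation.Binary.Core using (Rel)
open import Relation.Binary.PropositionalEquality using (_≡_)
open import Relation.Binary.Structures using (IsStrictTotalOrder)
open import Relation.Unary
  using (Pred; _∈_; _≐_; ∁; _∩_; _∪_; ⋂; ⋃; Satisfiable)

record Language (ℓ : Level) : Set (lsuc ℓ) where
  field
    FunSym : ℕ → Set ℓ
    RelSym : ℕ → Set ℓ

module _ {ℓ : Level} (L : Language ℓ) where
  open Language L

  data Term (n : ℕ) : Set ℓ where
    var  : Fin n → Term n
    func : ∀ {k} → FunSym k → Vec (Term n) k → Term n

  -- Formulas with free variables among n de Bruijn indices; the
  -- quantifiers bind index 0.  A formula φ(x; ȳ) with lg(ȳ) = k is a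
  -- Formula (suc k) in which x is index 0.
  data Formula (n : ℕ) : Set ℓ where
    equal : Term n → Term n → Formula n
    rel   : ∀ {k} → RelSym k → Vec (Term n) k → Formula n
    ⊥ᶠ    : Formula n
    _⇒ᶠ_ _∧ᶠ_ _∨ᶠ_ : Formula n → Formula n → Formula n
    ∀ᶠ ∃ᶠ : Formula (suc n) → Formula n

  Sentence : Set ℓ
  Sentence = Formula 0

  Theory : Set (lsuc ℓ)
  Theory = Pred Sentence ℓ

  record Structure (u : Level) : Set (ℓ ⊔ lsuc u) where
    field
      Carrier  : Set u
      nonempty : Carrier
      ⟦_⟧ᶠ     : ∀ {k} → FunSym k → Vec Carrier k → Carrier
      ⟦_⟧ʳ     : ∀ {k} → RelSym k → Pred (Vec Carrier k) u

¬ᶠ_ : ∀ {ℓ} {L : Language ℓ} {n} → Formula L n → Formula L n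
¬ᶠ φ = φ ⇒ᶠ ⊥ᶠ

module _ {ℓ u : Level} {L : Language ℓ} (M : Structure L u) where
  open Structure M

  mutual
    eval : ∀ {n} → Vec Carrier n → Term L n → Carrier
    eval ρ (var i)     = lookup ρ i
    eval ρ (func f ts) = ⟦ f ⟧ᶠ (evals ρ ts)

    evals : ∀ {n k} → Vec Carrier n → Vec (Term L n) k → Vec Carrier k
    evals ρ []       = []
    evals ρ (t ∷ ts) = eval ρ t ∷ evals ρ ts

  Sat : ∀ {n} → Formula L n → Vec Carrier n → Set u
  Sat (equal s t) ρ = eval ρ s ≡ eval ρ t
  Sat (rel R ts)  ρ = ⟦ R ⟧ʳ (evals ρ ts)
  Sat ⊥ᶠ          ρ = ⊥
  Sat (φ ⇒ᶠ ψ)    ρ = Sat φ ρ → Sat ψ ρ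
  Sat (φ ∧ᶠ ψ)    ρ = Sat φ ρ × Sat ψ ρ
  Sat (φ ∨ᶠ ψ)    ρ = Sat φ ρ ⊎ Sat ψ ρ
  Sat (∀ᶠ φ)      ρ = ∀ a → Sat φ (a ∷ ρ)
  Sat (∃ᶠ φ)      ρ = ∃[ a ] Sat φ (a ∷ ρ)

  -- φ(M; b̄)
  DefinedSet : ∀ {k} → Formula L (suc k) → Vec Carrier k → Pred Carrier u
  DefinedSet φ b a = Sat φ (a ∷ b)

  IsModel : Theory L → Set (ℓ ⊔ u)
  IsModel T = ∀ {σ} → σ ∈ T → Sat σ []

-- Semantic consequence and completeness, with structures ranging over
-- the universe Set u.
Entails : ∀ {ℓ} (u : Level) {L : Language ℓ} →
          Theory L → Sentence L → Set (ℓ ⊔ lsuc u)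
Entails u {L} T σ = (M : Structure L u) → IsModel M T → Sat M σ []

record IsComplete {ℓ} (u : Level) {L : Language ℓ} (T : Theory L) :
                  Set (ℓ ⊔ lsuc u) where
  field
    satisfiable : Σ[ M ∈ Structure L u ] IsModel M T
    decides     : ∀ σ → Entails u T σ ⊎ Entails u T (¬ᶠ σ)

record Automorphism {ℓ u} {L : Language ℓ} (M : Structure L u) :
                    Set (ℓ ⊔ u) where
  open Language L
  open Structure M
  field
    bijection : Carrier ↔ Carrier
  open Inverse bijection public using (to)
  field
    preserves-fun : ∀ {k} (f : FunSym k) (as : Vec Carrier k) →
                    to (⟦ f ⟧ᶠ as) ≡ ⟦ f ⟧ᶠ (map to as)
    preserves-rel : ∀ {k} (R : RelSym k) (as : Vec Carrier k) →
                    ⟦ R ⟧ʳ as ⇔ ⟦ R ⟧ʳ (map to as)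

-- Formulas ψ(x₁,…,xₙ) with parameters from A: an L-formula whose
-- variables are x₁,…,xₙ followed by k slots for elements of A.
FormulaOver : ∀ {ℓ} → Language ℓ → Set ℓ → ℕ → Set ℓ
FormulaOver L A n = Σ[ k ∈ ℕ ] Formula L (n + k) × Vec A k

-- Saturated and strongly homogeneous with respect to small sets, where
-- "small" means indexed by a type in Set ℓ, the universe containing the
-- symbols of L.  So the role of the large cardinal κ > |L| is played by
-- the size of Set ℓ, and a typical monster model has its carrier in
-- Set u with u > ℓ.
record MonsterModel {ℓ} (u : Level) {L : Language ℓ} (T : Theory L) :
                    Set (lsuc ℓ ⊔ lsuc u) where
  field
    structure : Structure L u
  open Structure structure public

  Realises : ∀ {A n} → (A → Carrier) → Vec Carrier n →
             Pred (FormulaOver L A n) u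
  Realises par c (_ , ψ , as) = Sat structure ψ (c ++ map par as)

  field
    isModel : IsModel structure T

    saturated : ∀ (A : Set ℓ) (par : A → Carrier) {n}
      (p : Pred (FormulaOver L A n) ℓ) →
      (∀ (Γ : List (FormulaOver L A n)) → All p Γ →
         ∃[ c ] All (Realises par c) Γ) →
      ∃[ c ] (∀ ψ → ψ ∈ p → Realises par c ψ)

    stronglyHomogeneous : ∀ (A : Set ℓ) (f g : A → Carrier) →
      (∀ {k} (φ : Formula L k) (as : Vec A k) →
         Sat structure φ (map f as) ⇔ Sat structure φ (map g as)) →
      Σ[ α ∈ Automorphism structure ]
        (∀ a → Automorphism.to α (f a) ≡ g a)

module _ {x ℓ : Level} {X : Set x} where

  _^_ : Pred X ℓ → Bool → Pred X ℓ
  B ^ true  = B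
  B ^ false = ∁ B

  Independent : ∀ {i} {I : Set i} → (I → Pred X ℓ) → Set (x ⊔ ℓ ⊔ i)
  Independent {I = I} ℬ =
    ∀ (s : I → Bool) → Satisfiable (⋂ I (λ i → ℬ i ^ s i))

  -- Some ℬ ⊆ 𝒜 with |ℬ| = N is independent; ℬ is enumerated without
  -- repetition, sets being compared extensionally.
  HasIndependentSubfamily : ∀ {a} → Pred (Pred X ℓ) a → ℕ →
                            Set (x ⊔ lsuc ℓ ⊔ a)
  HasIndependentSubfamily 𝒜 N =
    Σ[ ℬ ∈ (Fin N → Pred X ℓ) ]
      (∀ i → ℬ i ∈ 𝒜) × Injective _≡_ _≐_ ℬ × Independent ℬ

  HasIndependenceDimension : ∀ {a} → Pred (Pred X ℓ) a → ℕ →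
                             Set (x ⊔ lsuc ℓ ⊔ a)
  HasIndependenceDimension 𝒜 N =
    HasIndependentSubfamily 𝒜 N ×
    (∀ N′ → HasIndependentSubfamily 𝒜 N′ → N′ ≤ N)

-- Φ = {φᵢ(x; ȳᵢ) : i ∈ I}
record FormulaFamily {ℓ} (L : Language ℓ) : Set (lsuc ℓ) where
  field
    I       : Set ℓ
    lg      : I → ℕ
    formula : (i : I) → Formula L (suc (lg i))

data BooleanCombination {a} (A : Set a) : Set a where
  atom    : A → BooleanCombination A
  ⊤ᵇ ⊥ᵇ   : BooleanCombination A
  ¬ᵇ_     : BooleanCombination A → BooleanCombination A
  _∧ᵇ_ _∨ᵇ_ : BooleanCombination A → BooleanCombination A →
              BooleanCombination A

module _ {a x ℓ} {A : Set a} {X : Set x} (⟦_⟧ : A → Pred X ℓ) where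

  ⟦_⟧ᵇ : BooleanCombination A → Pred X ℓ
  ⟦ atom i ⟧ᵇ = ⟦ i ⟧
  ⟦ ⊤ᵇ ⟧ᵇ     = λ _ → ⊤
  ⟦ ⊥ᵇ ⟧ᵇ     = λ _ → ⊥
  ⟦ ¬ᵇ θ ⟧ᵇ   = ∁ ⟦ θ ⟧ᵇ
  ⟦ θ ∧ᵇ χ ⟧ᵇ = ⟦ θ ⟧ᵇ ∩ ⟦ χ ⟧ᵇ
  ⟦ θ ∨ᵇ χ ⟧ᵇ = ⟦ θ ⟧ᵇ ∪ ⟦ χ ⟧ᵇ

module _ {ℓ u} {L : Language ℓ} {T : Theory L}
         (ℭ : MonsterModel u T) where
  open MonsterModel ℭ

  module _ (Φ : FormulaFamily L) where
    open FormulaFamily Φ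

    Instance : Set (ℓ ⊔ u)
    Instance = Σ[ i ∈ I ] Vec Carrier (lg i)

    instanceSet : Instance → Pred Carrier u
    instanceSet (i , b) = DefinedSet structure (formula i) b

    IsVCInstantiable : Set (ℓ ⊔ lsuc u)
    IsVCInstantiable =
      ∃[ N ] N ≤ 1 ×
        HasIndependenceDimension
          (λ (B : Pred Carrier u) → ∃[ ι ] B ≐ instanceSet ι) N

  -- Equivalence of formulas ψ(x), θ(x) with parameters from ℭ is
  -- ℭ ⊨ ∀x (ψ(x) ↔ θ(x)), that is, equality of the sets they define.
  IsVCMinimal : Set (lsuc ℓ ⊔ lsuc u)
  IsVCMinimal =
    Σ[ Φ ∈ FormulaFamily L ] IsVCInstantiable Φ ×
      (∀ {k} (ψ : Formula L (suc k)) (d : Vec Carrier k) →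
        Σ[ θ ∈ BooleanCombination (Instance Φ) ]
          DefinedSet structure ψ d ≐ ⟦ instanceSet Φ ⟧ᵇ θ)

module _ {u} {X : Set u} (_<_ : Rel X u) where

  IsConvex : Pred X u → Set u
  IsConvex S = ∀ {a b c} → a ∈ S → c ∈ S → a < b → b < c → b ∈ S

  IsUnionOfAtMost : ℕ → Pred X u → Set (lsuc u)
  IsUnionOfAtMost K P =
    ∃[ n ] n ≤ K × Σ[ S ∈ (Fin n → Pred X u) ]
      (∀ i → IsConvex (S i)) × P ≐ ⋃ (Fin n) S

IsConvexlyOrderableStructure : ∀ {ℓ u} {L : Language ℓ} →
                               Structure L u → Set (ℓ ⊔ lsuc u)
IsConvexlyOrderableStructure {u = u} {L} M =
  Σ (Rel Carrier u) λ _<_ → IsStrictTotalOrder _≡_ _<_ ×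
    (∀ {k} (φ : Formula L (suc k)) →
      ∃[ K ] (∀ (b : Vec Carrier k) →
        IsUnionOfAtMost _<_ K (DefinedSet M φ b)))
  where open Structure M

IsConvexlyOrderable : ∀ {ℓ} (u : Level) {L : Language ℓ} →
                      Theory L → Set (ℓ ⊔ lsuc u)
IsConvexlyOrderable u {L} T =
  (M : Structure L u) → IsModel M T → IsConvexlyOrderableStructure M

{-# OPTIONS --safe #-}
module Submission where

-- In a VC-minimal theory no two instances of the generating family Φ cross: of
-- the four regions cut out by two instances one is empty.  This is first order,
-- so by completeness it holds in every model M.  Replacing each instance by its
-- complement if it contains a fixed point of M, the resulting balls are pairwise
-- nested or disjoint.  Such a laminar family is made convex by a linear order:
-- given x ≠ y, let E be the relation of being equal or in a common ball that does
-- not contain both x and y.  It is an equivalence relation separating x from y;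
-- compare the chosen representatives of their E-classes in an arbitrary linear
-- order of M.  By saturation of ℭ every formula ψ(x; ȳ) is, uniformly in ȳ, one of
-- finitely many Boolean combinations of instances of Φ.  This again passes to M,
-- and a Boolean combination of convex sets is a union of boundedly many of them.

open import Axiom.ExcludedMiddle using (ExcludedMiddle)
open import Axiom.Extensionality.Propositional using (Extensionality)
open import Data.Bool using (Bool; true; false; not; T)
open import Data.Empty using (⊥-elim)
open import Data.Empty.Polymorphic using () renaming (⊥ to ⊥ₚ; ⊥-elim to ⊥ₚ-elim)
open import Data.Fin using (Fin; zero; suc; _↑ˡ_; _↑ʳ_; splitAt; combine; remQuot; lift)
open import Data.Fin.Properties using (splitAt-↑ˡ; splitAt-↑ʳ; remQuot-combine)
open import Data.List as List using (List; []; _∷_)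
open import Data.List.Relation.Unary.All using (All; []; _∷_; reduce)
open import Data.List.Relation.Unary.Any using (Any; here; there)
open import Data.Nat using (ℕ; zero; suc; _+_; _*_; _^_; _≤_; z≤n; s≤s)
open import Data.Nat.ListAction using (sum)
open import Data.Nat.Properties using (≤-refl; <⇒≱; ≤-trans; +-mono-≤; *-mono-≤; ^-monoʳ-≤; m≤m+n; m≤n+m)
open import Data.Product using (Σ-syntax; ∃; ∃-syntax; _×_; _,_; proj₁; proj₂; swap)
open import Data.Product.Function.NonDependent.Propositional using (_×-⇔_)
open import Data.Sum using (_⊎_; inj₁; inj₂; [_,_]′)
open import Data.Sum.Function.Propositional using (_⊎-⇔_)
open import Data.Vec as Vec using (Vec; []; _∷_; _++_; lookup)
open import Data.Vec.Properties using (lookup-++ˡ; lookup-++ʳ)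
open import Function using (_∘_; id)
open import Function.Bundles using (_⇔_; mk⇔; Equivalence)
open import Function.Construct.Identity using (⇔-id)
open import Function.Construct.Composition using (_⇔-∘_)
open import Function.Construct.Symmetry using (⇔-sym)
open import Level using (Level; _⊔_) renaming (suc to lsuc)
open import Relation.Binary.Core using (Rel)
open import Relation.Binary.Definitions using (tri<; tri≈; tri>; Transitive; Trichotomous)
open import Relation.Binary.PropositionalEquality
  using (_≡_; _≢_; refl; sym; trans; cong; cong₂; subst; isEquivalence)
open import Relation.Binary.Structures using (IsStrictTotalOrder)
open import Relation.Nullary using (¬_; yes; no)
open import Relation.Nullary.Decidable using (⌊_⌋; toWitness; fromWitness)
open import Relation.Unary using (Pred; _∈_; _∉_; _⊆_; _≐_; ∁; _∩_; _∪_; ⋃; Satisfiable)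
open import Defs hiding (_^_)
open Defs using () renaming (_^_ to _^ᵇ_)

private variable
  a b i ℓ u : Level

-- Classical logic and Boolean truth values.

module Classical (em : ∀ {a} → ExcludedMiddle a) where

  dne : {P : Set a} → ¬ ¬ P → P
  dne {P = P} ¬¬p with em {P = P}
  ... | yes p = p
  ... | no ¬p = ⊥-elim (¬¬p ¬p)

  ¬∀⟶∃¬ : {A : Set a} {P : A → Set b} → ¬ (∀ x → P x) → ∃ λ x → ¬ P x
  ¬∀⟶∃¬ ¬all = dne λ ¬ex → ¬all λ x → dne λ ¬p → ¬ex (x , ¬p)

  -- Abstract so that P can be inferred from T ⌈ P ⌉.
  abstract
    ⌈_⌉ : Set a → Bool
    ⌈ P ⌉ = ⌊ em {P = P} ⌋

    ⌈⌉⁺ : {P : Set a} → P → T ⌈ P ⌉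
    ⌈⌉⁺ = fromWitness

    ⌈⌉⁻ : {P : Set a} → T ⌈ P ⌉ → P
    ⌈⌉⁻ = toWitness

    ⌈⌉-cong : {P Q : Set a} → (P → Q) → (Q → P) → ⌈ P ⌉ ≡ ⌈ Q ⌉
    ⌈⌉-cong {P = P} {Q} f g with em {P = P} | em {P = Q}
    ... | yes _ | yes _ = refl
    ... | no _  | no _  = refl
    ... | yes p | no ¬q = ⊥-elim (¬q (f p))
    ... | no ¬p | yes q = ⊥-elim (¬p (g q))

  T-ext : ∀ {p q} → (T p → T q) → (T q → T p) → p ≡ q
  T-ext {true}  {true}  _ _ = refl
  T-ext {false} {false} _ _ = refl
  T-ext {true}  {false} f _ = ⊥-elim (f _)
  T-ext {false} {true}  _ g = ⊥-elim (g _)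

-- A linear order on an arbitrary set, from a choice function.

module LinearOrder (em : ∀ {a} → ExcludedMiddle a)
                   (ext : ∀ {a b} → Extensionality a b)
                   (X : Set u) (x₀ : X) where
  open Classical em

  -- Subsets are Bool-valued so that the powerset of X stays in Set u.
  Subset : Set u
  Subset = X → Bool

  infix 4 _⊑_

  _⊑_ : Subset → Subset → Set u
  A ⊑ B = ∀ {x} → T (A x) → T (B x)

  ⊑-antisym : ∀ {A B} → A ⊑ B → B ⊑ A → A ≡ B
  ⊑-antisym A⊑B B⊑A = ext λ _ → T-ext A⊑B B⊑A

  -- Deciding a Σ-type yields a witness, so excluded middle gives a choice function. It sees only
  -- the Boolean predicate, so subsets with the same members get the same point; `x₀` is the junk
  -- value at the empty set.
  ε : Subset → X
  ε A with em {P = ∃ λ x → T (A x)}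
  ... | yes (x , _) = x
  ... | no _        = x₀

  ε-∈ : ∀ (A : Subset) {x : X} → T (A x) → T (A (ε A))
  ε-∈ A x∈A with em {P = ∃ λ x → T (A x)}
  ... | yes (_ , p) = p
  ... | no none     = ⊥-elim (none (_ , x∈A))

  next : Subset → X
  next A = ε (λ x → ⌈ ¬ T (A x) ⌉)

  next-∉ : ∀ (A : Subset) {x : X} → ¬ T (A x) → ¬ T (A (next A))
  next-∉ A x∉A = ⌈⌉⁻ (ε-∈ (λ x → ⌈ ¬ T (A x) ⌉) (⌈⌉⁺ x∉A))

  add : Subset → Subset
  add A x = ⌈ T (A x) ⊎ x ≡ next A ⌉

  ⊑-add : ∀ A → A ⊑ add A
  ⊑-add A = ⌈⌉⁺ ∘ inj₁

  ⊔ˢ : (Subset → Bool) → Subset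
  ⊔ˢ 𝒮 x = ⌈ (∃ λ A → T (𝒮 A) × T (A x)) ⌉

  -- Zermelo's tower: the transfinite enumeration of X by the choice function.
  data Tower : Subset → Set u where
    add-tower : ∀ {A} → Tower A → Tower (add A)
    -- The empty `𝒮` gives the first stage, the empty set.
    sup-tower : ∀ 𝒮 → (∀ A → T (𝒮 A) → Tower A) → Tower (⊔ˢ 𝒮)

  ⊑-⊔ˢ : ∀ 𝒮 {A} → T (𝒮 A) → A ⊑ ⊔ˢ 𝒮
  ⊑-⊔ˢ 𝒮 A∈𝒮 x∈A = ⌈⌉⁺ (_ , A∈𝒮 , x∈A)

  ⊔ˢ-least : ∀ 𝒮 {B} → (∀ A → T (𝒮 A) → A ⊑ B) → ⊔ˢ 𝒮 ⊑ B
  ⊔ˢ-least 𝒮 below x∈⊔ with ⌈⌉⁻ x∈⊔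
  ... | A , A∈𝒮 , x∈A = below A A∈𝒮 x∈A

  ⊑-or-member⋢ : ∀ 𝒮 B → (⊔ˢ 𝒮 ⊑ B) ⊎ (∃ λ A → T (𝒮 A) × ¬ (A ⊑ B))
  ⊑-or-member⋢ 𝒮 B with em {P = ∃ λ A → T (𝒮 A) × ¬ (A ⊑ B)}
  ... | yes found = inj₂ found
  ... | no none   = inj₁ (⊔ˢ-least 𝒮 {B} λ A A∈𝒮 → dne λ A⋢B → none (A , A∈𝒮 , A⋢B))

  -- The extreme points of the Bourbaki-Witt argument: comparability of all stages is proved through
  -- them by two inductions.
  Extreme : Subset → Set u
  Extreme B = ∀ {Z} → Tower Z → Z ⊑ B → (B ⊑ Z) ⊎ (add Z ⊑ B)

  -- Induction on the stage `A`. By extremeness a stage inside `B` stays inside after one step or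
  -- equals `B`; a union is inside `B` or has a member beyond it.
  extreme-comparable : ∀ {B} → Extreme B → ∀ {A} → Tower A → (A ⊑ B) ⊎ (add B ⊑ A)
  extreme-comparable {B} extB (add-tower {A} tA) with extreme-comparable extB tA
  ... | inj₂ addB⊑A = inj₂ λ p → ⊑-add A (addB⊑A p)
  ... | inj₁ A⊑B with extB tA A⊑B
  ...   | inj₂ addA⊑B = inj₁ addA⊑B
  ...   | inj₁ B⊑A = inj₂ λ {x} → subst (λ C → T (add C x)) (⊑-antisym B⊑A A⊑B)
  extreme-comparable {B} extB (sup-tower 𝒮 tow) with ⊑-or-member⋢ 𝒮 B
  ... | inj₁ below = inj₁ below
  ... | inj₂ (A , A∈𝒮 , A⋢B) with extreme-comparable extB (tow A A∈𝒮)
  ...   | inj₁ A⊑B    = ⊥-elim (A⋢B A⊑B)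
  ...   | inj₂ addB⊑A = inj₂ λ p → ⊑-⊔ˢ 𝒮 A∈𝒮 (addB⊑A p)

  -- Induction on `B`: comparing `Z` with the predecessor of `B`, or with a member of the union not
  -- inside `Z`, reduces to an earlier stage.
  tower-extreme : ∀ {B} → Tower B → Extreme B
  tower-extreme (add-tower {B} tB) {Z} tZ Z⊑addB
    with extreme-comparable (tower-extreme tB) tZ
  ... | inj₂ addB⊑Z = inj₁ addB⊑Z
  ... | inj₁ Z⊑B with tower-extreme tB tZ Z⊑B
  ...   | inj₂ addZ⊑B = inj₂ λ p → ⊑-add B (addZ⊑B p)
  ...   | inj₁ B⊑Z = inj₂ λ {x} → subst (λ C → T (add C x)) (⊑-antisym Z⊑B B⊑Z)
  tower-extreme (sup-tower 𝒮 tow) {Z} tZ Z⊑⊔ with ⊑-or-member⋢ 𝒮 Z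
  ... | inj₁ below = inj₁ below
  ... | inj₂ (A , A∈𝒮 , A⋢Z) with extreme-comparable (tower-extreme (tow A A∈𝒮)) tZ
  ...   | inj₂ addA⊑Z = ⊥-elim (A⋢Z λ p → addA⊑Z (⊑-add A p))
  ...   | inj₁ Z⊑A with tower-extreme (tow A A∈𝒮) tZ Z⊑A
  ...     | inj₁ A⊑Z    = ⊥-elim (A⋢Z A⊑Z)
  ...     | inj₂ addZ⊑A = inj₂ λ p → ⊑-⊔ˢ 𝒮 A∈𝒮 (addZ⊑A p)

  tower-total : ∀ {A B} → Tower A → Tower B → (A ⊑ B) ⊎ (B ⊑ A)
  tower-total {B = B} tA tB with extreme-comparable (tower-extreme tB) tA
  ... | inj₁ A⊑B    = inj₁ A⊑B
  ... | inj₂ addB⊑A = inj₂ λ p → addB⊑A (⊑-add B p)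

  avoiding : X → Subset → Bool
  avoiding x A = ⌈ Tower A × ¬ T (A x) ⌉

  below : X → Subset
  below x = ⊔ˢ (avoiding x)

  below-tower : ∀ x → Tower (below x)
  below-tower x = sup-tower (avoiding x) λ A A∈ → proj₁ (⌈⌉⁻ A∈)

  ∉-below : ∀ x → ¬ T (below x x)
  ∉-below x x∈ with ⌈⌉⁻ x∈
  ... | A , A∈ , x∈A = proj₂ (⌈⌉⁻ A∈) x∈A

  below-greatest : ∀ {x A} → Tower A → ¬ T (A x) → A ⊑ below x
  below-greatest {x} tA x∉A = ⊑-⊔ˢ (avoiding x) (⌈⌉⁺ (tA , x∉A))

  -- Otherwise adding one point to `below x` would give a stage still missing `x`, hence inside
  -- `below x`, although the added point is new.
  next-below : ∀ x → next (below x) ≡ x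
  next-below x = dne λ next≢x →
    let x∉add : ¬ T (add (below x) x)
        x∉add x∈ = [ ∉-below x , (λ x≡next → next≢x (sym x≡next)) ]′ (⌈⌉⁻ x∈)
    in next-∉ (below x) (∉-below x)
         (below-greatest (add-tower (below-tower x)) x∉add (⌈⌉⁺ (inj₂ refl)))

  infix 4 _<₀_

  _<₀_ : Rel X u
  x <₀ y = ∃ λ A → Tower A × T (A x) × ¬ T (A y)

  <₀-irrefl : ∀ {x} → ¬ (x <₀ x)
  <₀-irrefl (_ , _ , x∈A , x∉A) = x∉A x∈A

  <₀-trans : Transitive _<₀_
  <₀-trans (A , tA , x∈A , y∉A) (B , tB , y∈B , z∉B) with tower-total tA tB
  ... | inj₁ A⊑B = B , tB , A⊑B x∈A , z∉B
  ... | inj₂ B⊑A = ⊥-elim (y∉A (B⊑A y∈B))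

  -- If neither point lies in the largest stage missing the other, these two stages contain each
  -- other, so their next points `x` and `y` agree.
  <₀-connex : ∀ {x y} → x ≢ y → (x <₀ y) ⊎ (y <₀ x)
  <₀-connex {x} {y} x≢y with em {P = T (below y x)} | em {P = T (below x y)}
  ... | yes x∈ | _      = inj₁ (below y , below-tower y , x∈ , ∉-below y)
  ... | no _   | yes y∈ = inj₂ (below x , below-tower x , y∈ , ∉-below x)
  ... | no x∉  | no y∉  = ⊥-elim (x≢y (trans (sym (next-below x))
          (trans (cong next (⊑-antisym (below-greatest (below-tower x) y∉)
                                       (below-greatest (below-tower y) x∉)))
                 (next-below y))))

-- A linear order making every set of a laminar family convex.

module LaminarOrder (em : ∀ {a} → ExcludedMiddle a)
                    (ext : ∀ {a b} → Extensionality a b)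
                    {X : Set u} (x₀ : X) {I : Set i} (F : I → Pred X u)
                    (laminar : ∀ i j {x y z} →
                       F i x → F j x → F i y → ¬ F j y → F j z → F i z) where
  open Classical em
  open LinearOrder em ext X x₀

  Both : X → X → I → Set u
  Both x y i = F i x × F i y

  -- A pair enters the construction only through the balls containing both points, so pairs with the
  -- same balls carry the same sibling relation.
  SameBalls : X → X → X → X → Set (u ⊔ i)
  SameBalls x y x′ y′ = ∀ i → Both x y i ⇔ Both x′ y′ i

  -- For u and v in the smallest ball containing x and y: they lie in the same
  -- child of that ball.
  Sibling : X → X → X → X → Set (u ⊔ i)
  Sibling x y u v = u ≡ v ⊎ (∃ λ i → Both u v i × ¬ Both x y i)

  sibling-sym : ∀ {x y u v} → Sibling x y u v → Sibling x y v u
  sibling-sym (inj₁ u≡v)           = inj₁ (sym u≡v)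
  sibling-sym (inj₂ (i , uv , sep)) = inj₂ (i , swap uv , sep)

  -- In the main case both balls contain `v`: either `u` lies in the second, or the first is not
  -- inside the second and so contains it, and `w` with it.
  sibling-trans : ∀ {x y u v w} → Sibling x y u v → Sibling x y v w → Sibling x y u w
  sibling-trans (inj₁ refl) vw = vw
  sibling-trans uv@(inj₂ _) (inj₁ refl) = uv
  sibling-trans {u = u} {w = w} (inj₂ (i , (iu , iv) , sepi)) (inj₂ (j , (jv , jw) , sepj))
    with em {P = F j u}
  ... | yes ju = inj₂ (j , (ju , jw) , sepj)
  ... | no ¬ju = inj₂ (i , (iu , laminar i j iv jv iu ¬ju jw) , sepi)

  sibling-resp : ∀ {x y x′ y′ u v} → SameBalls x y x′ y′ → Sibling x y u v → Sibling x′ y′ u v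
  sibling-resp same (inj₁ u≡v)            = inj₁ u≡v
  sibling-resp same (inj₂ (i , uv , sep)) = inj₂ (i , uv , sep ∘ Equivalence.from (same i))

  class : X → X → X → Subset
  class x y u v = ⌈ Sibling x y u v ⌉

  rep : X → X → X → X
  rep x y u = ε (class x y u)

  rep-sibling : ∀ x y u → Sibling x y u (rep x y u)
  rep-sibling x y u = ⌈⌉⁻ (ε-∈ (class x y u) {u} (⌈⌉⁺ (inj₁ refl)))

  -- By extensionality the two classes are the same Boolean predicate, and `ε` is a function of that
  -- predicate.
  rep-cong : ∀ {x y x′ y′ u u′} → SameBalls x y x′ y′ → Sibling x y u u′ →
             rep x y u ≡ rep x′ y′ u′
  rep-cong same uu′ = cong ε (ext λ v → ⌈⌉-cong
    (λ uv → sibling-resp same (sibling-trans (sibling-sym uu′) uv))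
    (λ u′v → sibling-trans uu′ (sibling-resp (⇔-sym ∘ same) u′v)))

  same-swap : ∀ {x y} → SameBalls x y y x
  same-swap i = mk⇔ swap swap

  infix 4 _<_

  _<_ : Rel X u
  x < y = rep x y x <₀ rep x y y

  <-via : ∀ {x y x′ y′} → SameBalls x y x′ y′ → Sibling x y x x′ → Sibling x y y y′ →
          x < y → x′ < y′
  <-via same xx′ yy′ x<y with rep-cong same xx′ | rep-cong same yy′
  ... | p | q rewrite p | q = x<y

  -- A ball containing `w` and one of `p`, `q` meets ball `i` without lying inside it, so it
  -- contains all of ball `i`.
  separated : ∀ {i p q w} → Both p q i → ¬ F i w → SameBalls w p w q
  separated {i} (ip , iq) ¬iw j =
    mk⇔ (λ (jw , jp) → jw , laminar j i jp ip jw ¬iw iq)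
        (λ (jw , jq) → jw , laminar j i jq iq jw ¬iw ip)

  same-trans : ∀ {x y x′ y′ x″ y″} → SameBalls x y x′ y′ → SameBalls x′ y′ x″ y″ →
               SameBalls x y x″ y″
  same-trans p q i = q i ⇔-∘ p i

  <-irrefl : ∀ {x} → ¬ (x < x)
  <-irrefl = <₀-irrefl

  -- Ball `i` forces the pairs `x`, `y` and `y`, `z` to have the same balls and puts `x` and `z` in
  -- one class, so the representative of `y` would lie both above and below a single point. This is
  -- what makes balls convex.
  no-return : ∀ {i x y z} → Both x z i → ¬ F i y → x < y → ¬ (y < z)
  no-return {i} {x} {y} {z} xz ¬iy x<y y<z =
    <₀-irrefl (<₀-trans x<y (subst (λ r → rep x y y <₀ r) (sym rep≡) y<z′))
    where
    same : SameBalls x y y z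
    same = same-trans same-swap (separated xz ¬iy)
    rep≡ : rep x y x ≡ rep y z z
    rep≡ = rep-cong same (inj₂ (i , xz , ¬iy ∘ proj₂))
    y<z′ : rep x y y <₀ rep y z z
    y<z′ = subst (λ r → r <₀ rep y z z) (sym (rep-cong same (inj₁ refl))) y<z

  -- A ball holding exactly two of the points makes them siblings relative to the third, so one
  -- comparison carries over or `no-return` applies. Without such a ball all three pairs have the
  -- same balls, and transitivity of `_<₀_` suffices.
  <-trans : Transitive _<_
  <-trans {x} {y} {z} x<y y<z
    with em {P = ∃ λ i → Both y z i × ¬ F i x}
       | em {P = ∃ λ i → Both x y i × ¬ F i z}
       | em {P = ∃ λ i → Both x z i × ¬ F i y}
  ... | yes (i , yz , ¬ix) | _ | _ =
    <-via (separated yz ¬ix) (inj₁ refl) (inj₂ (i , yz , ¬ix ∘ proj₁)) x<y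
  ... | no _ | yes (i , xy , ¬iz) | _ =
    <-via (same-trans same-swap (same-trans (separated (swap xy) ¬iz) same-swap))
          (inj₂ (i , swap xy , ¬iz ∘ proj₂)) (inj₁ refl) y<z
  ... | no _ | no _ | yes (i , xz , ¬iy) = ⊥-elim (no-return xz ¬iy x<y y<z)
  ... | no ¬yz | no ¬xy | no ¬xz =
    <₀-trans (subst (λ r → r <₀ rep x z y) (rep-cong xy≈xz (inj₁ refl))
                (subst (λ r → rep x y x <₀ r) (rep-cong xy≈xz (inj₁ refl)) x<y))
             (subst (λ r → r <₀ rep x z z) (rep-cong yz≈xz (inj₁ refl))
                (subst (λ r → rep y z y <₀ r) (rep-cong yz≈xz (inj₁ refl)) y<z))
    where
    xy≈xz : SameBalls x y x z
    xy≈xz j = mk⇔ (λ (jx , jy) → jx , dne λ ¬jz → ¬xy (j , (jx , jy) , ¬jz))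
                  (λ (jx , jz) → jx , dne λ ¬jy → ¬xz (j , (jx , jz) , ¬jy))
    yz≈xz : SameBalls y z x z
    yz≈xz j = mk⇔ (λ (jy , jz) → dne (λ ¬jx → ¬yz (j , (jy , jz) , ¬jx)) , jz)
                  (λ (jx , jz) → dne (λ ¬jy → ¬xz (j , (jx , jz) , ¬jy)) , jz)

  <-asym : ∀ {x y} → x < y → ¬ (y < x)
  <-asym x<y y<x = <-irrefl (<-trans x<y y<x)

  -- The common representative makes `x` and `y` siblings with respect to themselves, and no ball
  -- containing both can fail to contain both.
  rep-injective : ∀ {x y} → rep x y x ≡ rep x y y → x ≡ y
  rep-injective {x} {y} eq
    with sibling-trans (subst (Sibling x y x) eq (rep-sibling x y x))
                       (sibling-sym (rep-sibling x y y))
  ... | inj₁ x≡y             = x≡y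
  ... | inj₂ (_ , xy , ¬xy) = ⊥-elim (¬xy xy)

  <-swap : ∀ {x y} → rep x y y <₀ rep x y x → y < x
  <-swap {x} {y} y<x =
    subst (λ r → r <₀ rep y x x) (rep-cong same-swap (inj₁ refl))
      (subst (λ r → rep x y y <₀ r) (rep-cong same-swap (inj₁ refl)) y<x)

  <-compare : Trichotomous _≡_ _<_
  <-compare x y with em {P = x ≡ y}
  ... | yes refl = tri≈ <-irrefl refl <-irrefl
  ... | no x≢y with <₀-connex (x≢y ∘ rep-injective)
  ...   | inj₁ x<y = tri< x<y x≢y (<-asym x<y)
  ...   | inj₂ y<x = tri> (<-asym (<-swap y<x)) x≢y (<-swap y<x)

  <-isStrictTotalOrder : IsStrictTotalOrder _≡_ _<_
  <-isStrictTotalOrder = record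
    { isStrictPartialOrder = record
        { isEquivalence = isEquivalence
        ; irrefl        = λ { refl → <-irrefl }
        ; trans         = <-trans
        ; <-resp-≈      = (λ { refl → id }) , (λ { refl → id })
        }
    ; compare = <-compare
    }

  F-convex : ∀ i → IsConvex _<_ (F i)
  F-convex i ia ic a<b b<c = dne λ ¬ib → no-return (ia , ic) ¬ib a<b b<c

-- Boolean operations on finite unions of convex sets.

module ConvexUnions (em : ∀ {a} → ExcludedMiddle a) {X : Set u} {_<_ : Rel X u}
                    (isOrder : IsStrictTotalOrder _≡_ _<_) where
  open Classical em
  open IsStrictTotalOrder isOrder using () renaming (trans to <-trans; irrefl to <-irrefl)

  Bounded : ℕ → Pred X u → Set (lsuc u)
  Bounded = IsUnionOfAtMost _<_

  bounded-mono : ∀ {K K′ P} → K ≤ K′ → Bounded K P → Bounded K′ P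
  bounded-mono K≤K′ (n , n≤K , rest) = n , ≤-trans n≤K K≤K′ , rest

  bounded-resp : ∀ {K P Q} → P ≐ Q → Bounded K P → Bounded K Q
  bounded-resp (P⊆Q , Q⊆P) (n , n≤K , S , cS , P⊆S , S⊆P) =
    n , n≤K , S , cS , (λ q → P⊆S (Q⊆P q)) , λ s → P⊆Q (S⊆P s)

  convex-bounded : ∀ {P} → IsConvex _<_ P → Bounded 1 P
  convex-bounded {P} cP = 1 , ≤-refl , (λ _ → P) , (λ _ → cP) , (λ p → zero , p) , proj₂

  empty-bounded : ∀ {P : Pred X u} → (∀ {x} → ¬ P x) → Bounded 0 P
  empty-bounded ¬P = 0 , z≤n , (λ ()) , (λ ()) , (λ p → ⊥-elim (¬P p)) , λ ()

  ∪-bounded : ∀ {K K′ P Q} → Bounded K P → Bounded K′ Q → Bounded (K + K′) (P ∪ Q)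
  ∪-bounded {P = P} {Q} (m , m≤K , S , cS , P⊆S , S⊆P) (n , n≤K′ , R , cR , Q⊆R , R⊆Q) =
    m + n , +-mono-≤ m≤K n≤K′ , U , cU , P∪Q⊆U , U⊆P∪Q
    where
    piece : Fin m ⊎ Fin n → Pred X _
    piece = [ S , R ]′
    cpiece : ∀ j → IsConvex _<_ (piece j)
    cpiece (inj₁ j) = cS j
    cpiece (inj₂ j) = cR j
    U : Fin (m + n) → Pred X _
    U = piece ∘ splitAt m
    cU : ∀ j → IsConvex _<_ (U j)
    cU j = cpiece (splitAt m j)
    P∪Q⊆U : (P ∪ Q) ⊆ ⋃ (Fin (m + n)) U
    P∪Q⊆U {x} (inj₁ p) with P⊆S p
    ... | j , s = j ↑ˡ n , subst (λ k → piece k x) (sym (splitAt-↑ˡ m j n)) s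
    P∪Q⊆U {x} (inj₂ q) with Q⊆R q
    ... | j , r = m ↑ʳ j , subst (λ k → piece k x) (sym (splitAt-↑ʳ m n j)) r
    U⊆P∪Q : ⋃ (Fin (m + n)) U ⊆ (P ∪ Q)
    U⊆P∪Q (j , p) with splitAt m j
    ... | inj₁ k = inj₁ (S⊆P (k , p))
    ... | inj₂ k = inj₂ (R⊆Q (k , p))

  ∩-bounded : ∀ {K K′ P Q} → Bounded K P → Bounded K′ Q → Bounded (K * K′) (P ∩ Q)
  ∩-bounded {P = P} {Q} (m , m≤K , S , cS , P⊆S , S⊆P) (n , n≤K′ , R , cR , Q⊆R , R⊆Q) =
    m * n , *-mono-≤ m≤K n≤K′ , U , cU , P∩Q⊆U ,
    λ (_ , s , r) → S⊆P (_ , s) , R⊆Q (_ , r)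
    where
    piece : Fin m × Fin n → Pred X _
    piece (j , k) = S j ∩ R k
    U : Fin (m * n) → Pred X _
    U = piece ∘ remQuot n
    cU : ∀ j → IsConvex _<_ (U j)
    cU j (sa , ra) (sc , rc) a<b b<c = cS _ sa sc a<b b<c , cR _ ra rc a<b b<c
    P∩Q⊆U : (P ∩ Q) ⊆ ⋃ (Fin (m * n)) U
    P∩Q⊆U {x} (p , q) with P⊆S p | Q⊆R q
    ... | j , s | k , r =
      combine j k , subst (λ jk → piece jk x) (sym (remQuot-combine j k)) (s , r)

  -- The two pieces are the points outside `C` with an element of `C` above them and those with
  -- none. In the first, a point of `C` below `z` would, by convexity, force `z` into `C`.
  ∁-convex-bounded : ∀ {C} → IsConvex _<_ C → Bounded 2 (∁ C)
  ∁-convex-bounded {C} cC =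
    bounded-resp ((λ { (inj₁ (x∉C , _)) → x∉C ; (inj₂ (x∉C , _)) → x∉C }) , split)
      (∪-bounded {P = left} {right} (convex-bounded left-convex) (convex-bounded right-convex))
    where
    left right : Pred X _
    left x  = x ∉ C × ∃ λ c → C c × x < c
    right x = x ∉ C × ¬ (∃ λ c → C c × x < c)
    split : ∁ C ⊆ (left ∪ right)
    split {x} x∉C with em {P = ∃ λ c → C c × x < c}
    ... | yes e = inj₁ (x∉C , e)
    ... | no ¬e = inj₂ (x∉C , ¬e)
    left-convex : IsConvex _<_ left
    left-convex _ (z∉C , c , c∈C , z<c) _ y<z =
      (λ y∈C → z∉C (cC y∈C c∈C y<z z<c)) , c , c∈C , <-trans y<z z<c
    right-convex : IsConvex _<_ right
    right-convex (_ , ¬above) _ x<y _ =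
      (λ y∈C → ¬above (_ , y∈C , x<y)) ,
      λ (c , c∈C , y<c) → ¬above (c , c∈C , <-trans x<y y<c)

  -- The complement is an intersection of `n` complements of at most 2 pieces each; for `n` zero it
  -- is everything, one piece.
  ∁-⋃-bounded : ∀ n (S : Fin n → Pred X u) → (∀ j → IsConvex _<_ (S j)) →
                Bounded (2 ^ n) (∁ (⋃ (Fin n) S))
  ∁-⋃-bounded zero S cS =
    bounded-resp {P = ∁ (⋃ (Fin 0) S)} (id , id) (convex-bounded λ _ _ _ _ ())
  ∁-⋃-bounded (suc n) S cS =
    bounded-resp ((λ { (h , _) (zero , s) → h s ; (_ , t) (suc j , s) → t (j , s) }) ,
                  λ h → (λ s → h (zero , s)) , λ (j , s) → h (suc j , s))
      (∩-bounded (∁-convex-bounded (cS zero)) (∁-⋃-bounded n (S ∘ suc) (cS ∘ suc)))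

  ∁-bounded : ∀ {K P} → Bounded K P → Bounded (2 ^ K) (∁ P)
  ∁-bounded (n , n≤K , S , cS , P⊆S , S⊆P) =
    bounded-mono (^-monoʳ-≤ 2 n≤K)
      (bounded-resp ((λ ¬s p → ¬s (P⊆S p)) , λ ¬p s → ¬p (S⊆P s)) (∁-⋃-bounded n S cS))

-- Renaming, quantifier blocks and finite disjunctions of formulas.

module _ {L : Language ℓ} where

  private variable
    m n : ℕ

  renameTerm  : (Fin m → Fin n) → Term L m → Term L n
  renameTerms : ∀ {k} → (Fin m → Fin n) → Vec (Term L m) k → Vec (Term L n) k
  renameTerm f (var j)     = var (f j)
  renameTerm f (func g ts) = func g (renameTerms f ts)
  renameTerms f []       = []
  renameTerms f (t ∷ ts) = renameTerm f t ∷ renameTerms f ts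

  rename : (Fin m → Fin n) → Formula L m → Formula L n
  rename f (equal s t) = equal (renameTerm f s) (renameTerm f t)
  rename f (rel R ts)  = rel R (renameTerms f ts)
  rename f ⊥ᶠ          = ⊥ᶠ
  rename f (φ ⇒ᶠ ψ)    = rename f φ ⇒ᶠ rename f ψ
  rename f (φ ∧ᶠ ψ)    = rename f φ ∧ᶠ rename f ψ
  rename f (φ ∨ᶠ ψ)    = rename f φ ∨ᶠ rename f ψ
  rename f (∀ᶠ φ)      = ∀ᶠ (rename (lift 1 f) φ)
  rename f (∃ᶠ φ)      = ∃ᶠ (rename (lift 1 f) φ)

  closure : Formula L n → Sentence L
  closure {zero}  φ = φ
  closure {suc n} φ = closure (∀ᶠ φ)

  ∃ᶠ* : ∀ m → Formula L (m + n) → Formula L n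
  ∃ᶠ* zero    φ = φ
  ∃ᶠ* (suc m) φ = ∃ᶠ* m (∃ᶠ φ)

  ⋁ᶠ : ∀ {a} {A : Set a} → (A → Formula L n) → List A → Formula L n
  ⋁ᶠ f []       = ⊥ᶠ
  ⋁ᶠ f (x ∷ xs) = f x ∨ᶠ ⋁ᶠ f xs

  signed : Bool → Formula L n → Formula L n
  signed true  φ = φ
  signed false φ = ¬ᶠ φ

-- Semantics of these operations.

module Satisfaction {L : Language ℓ} (M : Structure L u) where
  open Structure M using (Carrier)

  private variable
    m n : ℕ

  -- A record rather than a bare function type, so that `f`, `ρ` and `ρ′` can be inferred from a
  -- proof.
  record Agree (f : Fin m → Fin n) (ρ : Vec Carrier m) (ρ′ : Vec Carrier n) : Set u where
    constructor agree
    field agrees : ∀ j → lookup ρ′ (f j) ≡ lookup ρ j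

  open Agree

  agree-lift : ∀ {f : Fin m → Fin n} {ρ ρ′} → Agree f ρ ρ′ → ∀ a →
               Agree (lift 1 f) (a ∷ ρ) (a ∷ ρ′)
  agree-lift ag a .agrees zero    = refl
  agree-lift ag a .agrees (suc j) = ag .agrees j

  eval-rename  : ∀ {f : Fin m → Fin n} {ρ ρ′} → Agree f ρ ρ′ → ∀ t →
                 eval M ρ′ (renameTerm f t) ≡ eval M ρ t
  evals-rename : ∀ {f : Fin m → Fin n} {ρ ρ′ k} → Agree f ρ ρ′ → ∀ (ts : Vec _ k) →
                 evals M ρ′ (renameTerms f ts) ≡ evals M ρ ts
  eval-rename ag (var j)     = ag .agrees j
  eval-rename ag (func g ts) = cong (Structure.⟦_⟧ᶠ M g) (evals-rename ag ts)
  evals-rename ag []       = refl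
  evals-rename ag (t ∷ ts) = cong₂ _∷_ (eval-rename ag t) (evals-rename ag ts)

  sat-rename : ∀ {f : Fin m → Fin n} {ρ ρ′} → Agree f ρ ρ′ → ∀ φ →
               Sat M (rename f φ) ρ′ ⇔ Sat M φ ρ
  sat-rename ag (equal s t) rewrite eval-rename ag s | eval-rename ag t = ⇔-id _
  sat-rename ag (rel R ts)  rewrite evals-rename ag ts = ⇔-id _
  sat-rename ag ⊥ᶠ          = ⇔-id _
  sat-rename ag (φ ⇒ᶠ ψ)    =
    mk⇔ (λ h p → Equivalence.to (sat-rename ag ψ) (h (Equivalence.from (sat-rename ag φ) p)))
        (λ h p → Equivalence.from (sat-rename ag ψ) (h (Equivalence.to (sat-rename ag φ) p)))
  sat-rename ag (φ ∧ᶠ ψ)    = sat-rename ag φ ×-⇔ sat-rename ag ψ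
  sat-rename ag (φ ∨ᶠ ψ)    = sat-rename ag φ ⊎-⇔ sat-rename ag ψ
  sat-rename ag (∀ᶠ φ)      =
    mk⇔ (λ h a → Equivalence.to (sat-rename (agree-lift ag a) φ) (h a))
        (λ h a → Equivalence.from (sat-rename (agree-lift ag a) φ) (h a))
  sat-rename ag (∃ᶠ φ)      =
    mk⇔ (λ (a , h) → a , Equivalence.to (sat-rename (agree-lift ag a) φ) h)
        (λ (a , h) → a , Equivalence.from (sat-rename (agree-lift ag a) φ) h)

  -- `lift 1` keeps `x` at index 0 while the parameters move into the left block.
  sat-renameˡ : ∀ (φ : Formula L (suc m)) {a} {b : Vec Carrier m} {c : Vec Carrier n} →
                Sat M (rename (lift 1 (_↑ˡ n)) φ) (a ∷ b ++ c) ⇔ Sat M φ (a ∷ b)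
  sat-renameˡ φ {a} {b} {c} = sat-rename (agree-lift (agree (lookup-++ˡ b c)) a) φ

  sat-renameʳ : ∀ (φ : Formula L (suc n)) {a} {b : Vec Carrier m} {c : Vec Carrier n} →
                Sat M (rename (lift 1 (m ↑ʳ_)) φ) (a ∷ b ++ c) ⇔ Sat M φ (a ∷ c)
  sat-renameʳ φ {a} {b} {c} = sat-rename (agree-lift (agree (lookup-++ʳ b c)) a) φ

  sat-closure : ∀ (φ : Formula L n) → Sat M (closure φ) [] ⇔ (∀ ρ → Sat M φ ρ)
  sat-closure {zero}  φ = mk⇔ (λ { h [] → h }) (λ h → h [])
  sat-closure {suc n} φ =
    mk⇔ (λ { h (a ∷ ρ) → Equivalence.to (sat-closure (∀ᶠ φ)) h ρ a })
        (λ h → Equivalence.from (sat-closure (∀ᶠ φ)) λ ρ a → h (a ∷ ρ))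

  sat-∃* : ∀ m (φ : Formula L (m + n)) {ρ} →
           Sat M (∃ᶠ* m φ) ρ ⇔ (∃[ as ] Sat M φ (as ++ ρ))
  sat-∃* zero    φ = mk⇔ (λ h → [] , h) (λ { ([] , h) → h })
  sat-∃* (suc m) φ =
    mk⇔ (λ h → let as , a , s = Equivalence.to (sat-∃* m (∃ᶠ φ)) h in a ∷ as , s)
        (λ { (a ∷ as , s) → Equivalence.from (sat-∃* m (∃ᶠ φ)) (as , a , s) })

  sat-⋁ : ∀ {a} {A : Set a} {f : A → Formula L n} {ρ} xs →
          Sat M (⋁ᶠ f xs) ρ ⇔ Any (λ x → Sat M (f x) ρ) xs
  sat-⋁ []       = mk⇔ (λ ()) (λ ())
  sat-⋁ (x ∷ xs) =
    mk⇔ [ here , there ∘ Equivalence.to (sat-⋁ xs) ]′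
        (λ { (here p) → inj₁ p ; (there p) → inj₂ (Equivalence.from (sat-⋁ xs) p) })

  sat-signed : ∀ s (φ : Formula L (suc n)) {a b} →
               Sat M (signed s φ) (a ∷ b) ⇔ (a ∈ DefinedSet M φ b ^ᵇ s)
  sat-signed true  φ = ⇔-id _
  -- `Sat` negates into the polymorphic empty type, `∁` into the ordinary one.
  sat-signed false φ = mk⇔ (λ h p → ⊥ₚ-elim (h p)) (λ h p → ⊥-elim (h p))

-- Crossing pairs of sets.

Crossing : {X : Set a} → Pred X b → Pred X b → Set (a ⊔ b)
Crossing B C = ∀ s t → Satisfiable ((B ^ᵇ s) ∩ (C ^ᵇ t))

module CrossingProperties (em : ∀ {a} → ExcludedMiddle a) {X : Set a} where
  open Classical em

  unsign : ∀ (B : Pred X b) σ s → ∃ λ s′ → ((B ^ᵇ σ) ^ᵇ s′) ⊆ (B ^ᵇ s)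
  unsign B true  s     = s , id
  unsign B false true  = false , dne
  unsign B false false = true , id

  -- Complementing `B` or `C` only permutes the four regions.
  uncross : ∀ {B C : Pred X b} σ τ → Crossing (B ^ᵇ σ) (C ^ᵇ τ) → Crossing B C
  uncross {B = B} {C} σ τ cross s t =
    let s′ , B⊆ = unsign B σ s
        t′ , C⊆ = unsign C τ t
        x , xB , xC = cross s′ t′
    in x , B⊆ xB , C⊆ xC

  sideAvoiding : X → Pred X b → Bool
  sideAvoiding x B = not ⌈ B x ⌉

  ∉-side : ∀ x (B : Pred X b) → x ∉ (B ^ᵇ sideAvoiding x B)
  ∉-side x B with ⌈ B x ⌉ in eq
  ... | true  = λ x∉B → x∉B (⌈⌉⁻ (subst T (sym eq) _))
  ... | false = λ x∈B → subst T eq (⌈⌉⁺ x∈B)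

-- Boolean combinations of instances as first-order formulas.

module Shapes {L : Language ℓ} (Φ : FormulaFamily L) where
  open FormulaFamily Φ

  -- A Boolean combination of instances with the parameters forgotten.
  Shape : Set ℓ
  Shape = BooleanCombination I

  arity : Shape → ℕ
  arity (atom i) = lg i
  arity ⊤ᵇ       = 0
  arity ⊥ᵇ       = 0
  arity (¬ᵇ θ)   = arity θ
  arity (θ ∧ᵇ χ) = arity θ + arity χ
  arity (θ ∨ᵇ χ) = arity θ + arity χ

  shapeFormula : ∀ θ → Formula L (suc (arity θ))
  shapeFormula (atom i) = formula i
  shapeFormula ⊤ᵇ       = ¬ᶠ ⊥ᶠ
  shapeFormula ⊥ᵇ       = ⊥ᶠ
  shapeFormula (¬ᵇ θ)   = ¬ᶠ shapeFormula θ
  shapeFormula (θ ∧ᵇ χ) = rename (lift 1 (_↑ˡ arity χ)) (shapeFormula θ) ∧ᶠ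
                          rename (lift 1 (arity θ ↑ʳ_)) (shapeFormula χ)
  shapeFormula (θ ∨ᵇ χ) = rename (lift 1 (_↑ˡ arity χ)) (shapeFormula θ) ∨ᶠ
                          rename (lift 1 (arity θ ↑ʳ_)) (shapeFormula χ)

  -- The parameters of the shape are quantified away and only those of `ψ` stay free, which makes
  -- the property accessible to saturation and completeness.
  hasShape : ∀ {k} → Formula L (suc k) → Shape → Formula L k
  hasShape {k} ψ θ = ∃ᶠ* (arity θ) (∀ᶠ ((ψ′ ⇒ᶠ θ′) ∧ᶠ (θ′ ⇒ᶠ ψ′)))
    where
    ψ′ θ′ : Formula L (suc (arity θ + k))
    ψ′ = rename (lift 1 (arity θ ↑ʳ_)) ψ
    θ′ = rename (lift 1 (_↑ˡ k)) (shapeFormula θ)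

  region : ∀ i j → Bool → Bool → Formula L (lg i + lg j)
  region i j s t = ∃ᶠ (rename (lift 1 (_↑ˡ lg j)) (signed s (formula i)) ∧ᶠ
                       rename (lift 1 (lg i ↑ʳ_)) (signed t (formula j)))

  -- The first-order form of `Crossing`, whose failure can be moved from ℭ to other models.
  crossing : ∀ i j → Formula L (lg i + lg j)
  crossing i j = (region i j true true ∧ᶠ region i j true false) ∧ᶠ
                 (region i j false true ∧ᶠ region i j false false)

  module _ (M : Structure L u) where
    open Structure M using (Carrier)
    open Satisfaction M

    -- Instances over an arbitrary structure; over that of ℭ they coincide by definition with
    -- `Instance ℭ Φ`.
    InstanceIn : Set (ℓ ⊔ u)
    InstanceIn = Σ[ i ∈ I ] Vec Carrier (lg i)

    ⟪_⟫ : InstanceIn → Pred Carrier u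
    ⟪ i , b ⟫ = DefinedSet M (formula i) b

    shape : BooleanCombination InstanceIn → Shape
    shape (atom (i , _)) = atom i
    shape ⊤ᵇ             = ⊤ᵇ
    shape ⊥ᵇ             = ⊥ᵇ
    shape (¬ᵇ θ)         = ¬ᵇ shape θ
    shape (θ ∧ᵇ χ)       = shape θ ∧ᵇ shape χ
    shape (θ ∨ᵇ χ)       = shape θ ∨ᵇ shape χ

    parameters : ∀ θ → Vec Carrier (arity (shape θ))
    parameters (atom (_ , b)) = b
    parameters ⊤ᵇ             = []
    parameters ⊥ᵇ             = []
    parameters (¬ᵇ θ)         = parameters θ
    parameters (θ ∧ᵇ χ)       = parameters θ ++ parameters χ
    parameters (θ ∨ᵇ χ)       = parameters θ ++ parameters χ

    sat-shape : ∀ θ {a} → Sat M (shapeFormula (shape θ)) (a ∷ parameters θ) ⇔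
                          (a ∈ ⟦ ⟪_⟫ ⟧ᵇ θ)
    sat-shape (atom _) = ⇔-id _
    sat-shape ⊤ᵇ       = mk⇔ (λ _ → _) (λ _ ())
    sat-shape ⊥ᵇ       = ⇔-id _
    sat-shape (¬ᵇ θ)   =
      mk⇔ (λ h p → ⊥ₚ-elim (h (Equivalence.from (sat-shape θ) p)))
          (λ h p → ⊥-elim (h (Equivalence.to (sat-shape θ) p)))
    sat-shape (θ ∧ᵇ χ) =
      (sat-shape θ ⇔-∘ sat-renameˡ (shapeFormula (shape θ))) ×-⇔
      (sat-shape χ ⇔-∘ sat-renameʳ (shapeFormula (shape χ)))
    sat-shape (θ ∨ᵇ χ) =
      (sat-shape θ ⇔-∘ sat-renameˡ (shapeFormula (shape θ))) ⊎-⇔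
      (sat-shape χ ⇔-∘ sat-renameʳ (shapeFormula (shape χ)))

    sat-hasShape : ∀ {k} (ψ : Formula L (suc k)) θ {d} →
      Sat M (hasShape ψ θ) d ⇔
      (∃[ b ] DefinedSet M ψ d ≐ DefinedSet M (shapeFormula θ) b)
    sat-hasShape {k} ψ θ {d} =
      mk⇔ (λ (b , h) → b ,
             (λ {a} p → to (sat-θ a) (proj₁ (h a) (from (sat-ψ a) p))) ,
             (λ {a} p → to (sat-ψ a) (proj₂ (h a) (from (sat-θ a) p))))
          (λ (b , h) → b , λ a →
             (λ p → from (sat-θ a) (proj₁ h (to (sat-ψ a) p))) ,
             (λ p → from (sat-ψ a) (proj₂ h (to (sat-θ a) p))))
      ⇔-∘ sat-∃* (arity θ) _
      where
      open Equivalence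
      sat-ψ : ∀ {b : Vec Carrier (arity θ)} a →
              Sat M (rename (lift 1 (arity θ ↑ʳ_)) ψ) (a ∷ b ++ d) ⇔ Sat M ψ (a ∷ d)
      sat-ψ a = sat-renameʳ ψ
      sat-θ : ∀ {b : Vec Carrier (arity θ)} a →
              Sat M (rename (lift 1 (_↑ˡ k)) (shapeFormula θ)) (a ∷ b ++ d) ⇔
              Sat M (shapeFormula θ) (a ∷ b)
      sat-θ a = sat-renameˡ (shapeFormula θ)

    sat-region : ∀ {i j} s t {b c} → Sat M (region i j s t) (b ++ c) ⇔
                 Satisfiable ((⟪ i , b ⟫ ^ᵇ s) ∩ (⟪ j , c ⟫ ^ᵇ t))
    sat-region {i} {j} s t {b} {c} =
      mk⇔ (λ (a , h) → a , Equivalence.to (both a) h)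
          (λ (a , h) → a , Equivalence.from (both a) h)
      where
      both : ∀ a → _ ⇔ _
      both a = (sat-signed s (formula i) {a} {b} ⇔-∘ sat-renameˡ (signed s (formula i))) ×-⇔
               (sat-signed t (formula j) {a} {c} ⇔-∘ sat-renameʳ (signed t (formula j)))

    sat-crossing : ∀ {i j b c} → Sat M (crossing i j) (b ++ c) ⇔
                   Crossing ⟪ i , b ⟫ ⟪ j , c ⟫
    sat-crossing {i} {j} {b} {c} = mk⇔ forward
      λ h → (from′ h true true , from′ h true false) , from′ h false true , from′ h false false
      where
      from′ : Crossing ⟪ i , b ⟫ ⟪ j , c ⟫ → ∀ s t → Sat M (region i j s t) (b ++ c)
      from′ h s t = Equivalence.from (sat-region s t) (h s t)
      forward : Sat M (crossing i j) (b ++ c) → Crossing ⟪ i , b ⟫ ⟪ j , c ⟫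
      forward ((p , q) , (r , s)) true  true  = Equivalence.to (sat-region true true) p
      forward ((p , q) , (r , s)) true  false = Equivalence.to (sat-region true false) q
      forward ((p , q) , (r , s)) false true  = Equivalence.to (sat-region false true) r
      forward ((p , q) , (r , s)) false false = Equivalence.to (sat-region false false) s

-- From the monster model to all models of `T`.

module VCMinimalTheory (em : ∀ {a} → ExcludedMiddle a) {L : Language ℓ} {T : Theory L}
                       (complete : IsComplete u T) (ℭ : MonsterModel u T)
                       (Φ : FormulaFamily L) (vc : IsVCInstantiable ℭ Φ)
                       (generates : ∀ {k} (ψ : Formula L (suc k)) d →
                          Σ[ θ ∈ BooleanCombination (Instance ℭ Φ) ]
                            DefinedSet (MonsterModel.structure ℭ) ψ d ≐
                            ⟦ instanceSet ℭ Φ ⟧ᵇ θ) where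
  open Classical em
  open Shapes Φ
  open FormulaFamily Φ
  open MonsterModel ℭ using (Carrier; Realises; saturated)
    renaming (structure to 𝔠; isModel to 𝔠-isModel)

  -- `T` decides the universal closure, and ℭ is a counterexample to its negation.
  transfer : ∀ {n} (φ : Formula L n) → (∀ ρ → Sat 𝔠 φ ρ) →
             (M : Structure L u) → IsModel M T → ∀ ρ → Sat M φ ρ
  transfer φ valid M M⊨T with IsComplete.decides complete (closure φ)
  ... | inj₁ entails = Equivalence.to (Satisfaction.sat-closure M φ) (entails M M⊨T)
  ... | inj₂ refutes = ⊥ₚ-elim
          (refutes 𝔠 𝔠-isModel (Equivalence.from (Satisfaction.sat-closure 𝔠 φ) valid))

  -- Crossing instances would form an independent family of two sets, distinct because the first has
  -- a point outside the second.
  no-crossing-in-ℭ : ∀ ι κ → ¬ Crossing (instanceSet ℭ Φ ι) (instanceSet ℭ Φ κ)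
  no-crossing-in-ℭ ι κ cross =
    let _ , N≤1 , _ , maximal = vc
    in <⇒≱ (s≤s N≤1)
         (maximal 2 (ℬ , (λ j → pick j , id , id) , injective , independent))
    where
    pick : Fin 2 → Instance ℭ Φ
    pick zero    = ι
    pick (suc _) = κ
    ℬ : Fin 2 → Pred Carrier u
    ℬ = instanceSet ℭ Φ ∘ pick
    injective : ∀ {j k} → ℬ j ≐ ℬ k → j ≡ k
    injective {zero}     {zero}     _ = refl
    injective {suc zero} {suc zero} _ = refl
    injective {zero}     {suc zero} (B⊆C , _) =
      let _ , x∈B , x∉C = cross true false in ⊥-elim (x∉C (B⊆C x∈B))
    injective {suc zero} {zero}     (_ , B⊆C) =
      let _ , x∈B , x∉C = cross true false in ⊥-elim (x∉C (B⊆C x∈B))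
    independent : Independent ℬ
    independent s with cross (s zero) (s (suc zero))
    ... | x , p , q = x , λ { zero → p ; (suc zero) → q }

  no-crossing : (M : Structure L u) → IsModel M T →
                ∀ ι κ → ¬ Crossing (⟪_⟫ M ι) (⟪_⟫ M κ)
  no-crossing M M⊨T (i , b) (j , c) cross =
    ⊥ₚ-elim (transfer (¬ᶠ crossing i j) valid M M⊨T (b ++ c)
              (Equivalence.from (sat-crossing M) cross))
    where
    valid : ∀ ρ → Sat 𝔠 (¬ᶠ crossing i j) ρ
    valid ρ h with Vec.splitAt (lg i) ρ
    ... | b′ , c′ , refl =
      ⊥-elim (no-crossing-in-ℭ (i , b′) (j , c′) (Equivalence.to (sat-crossing 𝔠) h))

  shape-in-ℭ : ∀ {k} (ψ : Formula L (suc k)) d → ∃[ θ ] Sat 𝔠 (hasShape ψ θ) d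
  shape-in-ℭ ψ d with generates ψ d
  ... | θ , ψ⊆θ , θ⊆ψ = shape 𝔠 θ , Equivalence.from (sat-hasShape 𝔠 ψ (shape 𝔠 θ))
    ( parameters 𝔠 θ
    , (λ p → Equivalence.from (sat-shape 𝔠 θ) (ψ⊆θ p))
    , (λ p → θ⊆ψ (Equivalence.to (sat-shape 𝔠 θ) p)))

  -- If no finite list of shapes sufficed, a tuple d for which ψ(x; d) has no
  -- shape at all would be finitely satisfiable, hence realised in ℭ.
  finitely-many-shapes : ∀ {k} (ψ : Formula L (suc k)) →
    ∃[ θs ] (∀ d → Any (λ θ → Sat 𝔠 (hasShape ψ θ) d) θs)
  finitely-many-shapes {k} ψ = dne λ none →
    let d , d-real = saturated ⊥ₚ ⊥ₚ-elim p (finitely-satisfiable none)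
        θ , h = shape-in-ℭ ψ d
    in ⊥ₚ-elim (Equivalence.to (sat-pad (¬ᶠ hasShape ψ θ)) (d-real _ (θ , refl)) h)
    where
    Enough : List Shape → Set (ℓ ⊔ u)
    Enough θs = ∀ d → Any (λ θ → Sat 𝔠 (hasShape ψ θ) d) θs
    -- There are no parameters, but `k + 0` is not `k` by definition, hence the renaming.
    pad : Formula L k → FormulaOver L (⊥ₚ {ℓ}) k
    pad χ = 0 , rename (_↑ˡ 0) χ , []
    -- Shapes lie in `Set ℓ`, so this type is small enough for saturation; combinations carrying
    -- their parameters would lie in `Set (ℓ ⊔ u)`.
    p : Pred (FormulaOver L (⊥ₚ {ℓ}) k) ℓ
    p χ = ∃[ θ ] χ ≡ pad (¬ᶠ hasShape ψ θ)
    sat-pad : ∀ χ {d} → Realises ⊥ₚ-elim d (pad χ) ⇔ Sat 𝔠 χ d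
    sat-pad χ {d} = Satisfaction.sat-rename 𝔠 (Satisfaction.agree (lookup-++ˡ d [])) χ
    all-realised : ∀ {d Γ} (ps : All p Γ) →
      ¬ Any (λ θ → Sat 𝔠 (hasShape ψ θ) d) (reduce proj₁ ps) → All (Realises ⊥ₚ-elim d) Γ
    all-realised [] _ = []
    all-realised ((θ , refl) ∷ ps) ¬any =
      Equivalence.from (sat-pad (¬ᶠ hasShape ψ θ)) (λ h → ⊥-elim (¬any (here h)))
      ∷ all-realised ps (¬any ∘ there)
    finitely-satisfiable : ¬ ∃ Enough → ∀ Γ → All p Γ → ∃[ d ] All (Realises ⊥ₚ-elim d) Γ
    finitely-satisfiable none Γ ps =
      -- The finitely many shapes occurring in `Γ` are not enough, so some `d` escapes all of them.
      let d , ¬any = ¬∀⟶∃¬ (λ h → none (reduce proj₁ ps , h))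
      in d , all-realised ps ¬any

  -- As the list is finite, its disjunction is a single formula valid in ℭ, hence in every model.
  shapes-in-model : ∀ {k} (ψ : Formula L (suc k)) → ∃[ θs ]
    ((M : Structure L u) → IsModel M T → ∀ d → Any (λ θ → Sat M (hasShape ψ θ) d) θs)
  shapes-in-model ψ with finitely-many-shapes ψ
  ... | θs , enough = θs , λ M M⊨T d → Equivalence.to (Satisfaction.sat-⋁ M θs)
    (transfer (⋁ᶠ (hasShape ψ) θs)
              (λ ρ → Equivalence.from (Satisfaction.sat-⋁ 𝔠 θs) (enough ρ)) M M⊨T d)

  -- The convex order on an arbitrary model.

  module _ (ext : ∀ {a b} → Extensionality a b)
           (M : Structure L u) (M⊨T : IsModel M T) where
    open Structure M using (nonempty) renaming (Carrier to X)
    open CrossingProperties em {X = X}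

    side : InstanceIn M → Bool
    side ι = sideAvoiding nonempty (⟪_⟫ M ι)

    ball : InstanceIn M → Pred X u
    ball ι = ⟪_⟫ M ι ^ᵇ side ι

    -- A failure would make the balls cross: `x`, `y`, `z` inhabit three regions, and the base
    -- point, which no ball contains, the fourth.
    balls-laminar : ∀ ι κ {x y z} → ball ι x → ball κ x → ball ι y → ¬ ball κ y →
                    ball κ z → ball ι z
    balls-laminar ι κ {x} {y} {z} ιx κx ιy ¬κy κz = dne λ ¬ιz →
      no-crossing M M⊨T ι κ (uncross (side ι) (side κ) λ where
        true  true  → x , ιx , κx
        true  false → y , ιy , ¬κy
        false true  → z , ¬ιz , κz
        false false → nonempty , ∉-side nonempty (⟪_⟫ M ι) , ∉-side nonempty (⟪_⟫ M κ))

    open LaminarOrder em ext nonempty ball balls-laminar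
      using (_<_; <-isStrictTotalOrder; F-convex)
    open ConvexUnions em <-isStrictTotalOrder

    -- An instance is a ball, hence convex, or the complement of one.
    instance-bounded : ∀ ι → Bounded 2 (⟪_⟫ M ι)
    instance-bounded ι = from-side (side ι) (F-convex ι)
      where
      from-side : ∀ s → IsConvex _<_ (⟪_⟫ M ι ^ᵇ s) → Bounded 2 (⟪_⟫ M ι)
      from-side true  convex = bounded-mono (s≤s z≤n) (convex-bounded convex)
      from-side false convex =
        bounded-resp (dne , λ p ¬p → ¬p p) (∁-convex-bounded convex)

    -- The bound depends on the shape alone, which gives uniformity in the parameters.
    shapeBound : Shape → ℕ
    shapeBound (atom _) = 2
    shapeBound ⊤ᵇ       = 1
    shapeBound ⊥ᵇ       = 0
    shapeBound (¬ᵇ θ)   = 2 ^ shapeBound θ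
    shapeBound (θ ∧ᵇ χ) = shapeBound θ * shapeBound χ
    shapeBound (θ ∨ᵇ χ) = shapeBound θ + shapeBound χ

    shape-bounded : ∀ θ b → Bounded (shapeBound θ) (DefinedSet M (shapeFormula θ) b)
    shape-bounded (atom i) b = instance-bounded (i , b)
    shape-bounded ⊤ᵇ b       = convex-bounded λ _ _ _ _ ()
    shape-bounded ⊥ᵇ b       = empty-bounded λ ()
    shape-bounded (¬ᵇ θ) b   =
      bounded-resp ((λ h p → ⊥-elim (h p)) , λ h p → ⊥ₚ-elim (h p)) (∁-bounded (shape-bounded θ b))
    shape-bounded (θ ∧ᵇ χ) bc with Vec.splitAt (arity θ) bc
    ... | b , c , refl = bounded-resp
      ((λ {a} → Equivalence.from (split a)) , λ {a} → Equivalence.to (split a))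
      (∩-bounded (shape-bounded θ b) (shape-bounded χ c))
      where
      split : ∀ a → Sat M (shapeFormula (θ ∧ᵇ χ)) (a ∷ b ++ c) ⇔
                    (Sat M (shapeFormula θ) (a ∷ b) × Sat M (shapeFormula χ) (a ∷ c))
      split a = Satisfaction.sat-renameˡ M (shapeFormula θ) ×-⇔
                Satisfaction.sat-renameʳ M (shapeFormula χ)
    shape-bounded (θ ∨ᵇ χ) bc with Vec.splitAt (arity θ) bc
    ... | b , c , refl = bounded-resp
      ((λ {a} → Equivalence.from (split a)) , λ {a} → Equivalence.to (split a))
      (∪-bounded (shape-bounded θ b) (shape-bounded χ c))
      where
      split : ∀ a → Sat M (shapeFormula (θ ∨ᵇ χ)) (a ∷ b ++ c) ⇔
                    (Sat M (shapeFormula θ) (a ∷ b) ⊎ Sat M (shapeFormula χ) (a ∷ c))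
      split a = Satisfaction.sat-renameˡ M (shapeFormula θ) ⊎-⇔
                Satisfaction.sat-renameʳ M (shapeFormula χ)

    -- Which shape occurs varies with `d`; the sum over the list dominates every one of them.
    any-shape-bounded : ∀ {k} (ψ : Formula L (suc k)) {d} θs →
      Any (λ θ → Sat M (hasShape ψ θ) d) θs →
      Bounded (sum (List.map shapeBound θs)) (DefinedSet M ψ d)
    any-shape-bounded ψ (θ ∷ θs) (here h) =
      let b , ψ⊆θ , θ⊆ψ = Equivalence.to (sat-hasShape M ψ θ) h
      in bounded-mono (m≤m+n _ _) (bounded-resp (θ⊆ψ , ψ⊆θ) (shape-bounded θ b))
    any-shape-bounded ψ (θ ∷ θs) (there any) =
      bounded-mono (m≤n+m _ _) (any-shape-bounded ψ θs any)

    convexly-orderable : IsConvexlyOrderableStructure M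
    convexly-orderable = _<_ , <-isStrictTotalOrder , λ ψ →
      let θs , enough = shapes-in-model ψ
      in sum (List.map shapeBound θs) , λ d → any-shape-bounded ψ θs (enough M M⊨T d)

theorem2p4 : (∀ {a} → ExcludedMiddle a) → (∀ {a b} → Extensionality a b) →
    ∀ {ℓ u : Level} (L : Language ℓ) (T : Theory L) → IsComplete u T →
    (ℭ : MonsterModel u T) → IsVCMinimal ℭ → IsConvexlyOrderable u T
theorem2p4 em ext L T complete ℭ (Φ , vc , generates) M M⊨T =
  VCMinimalTheory.convexly-orderable em complete ℭ Φ vc generates ext M M⊨T
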